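{- Let $\mathcal C$ be an immersed curve and $P_1,P_2,\dots,P_N$ distinct points on $\mathcal C$ listed in order along $\mathcal C$. Assume there are positive constants $A_0$ and $R_0$ such that (a) for all $j$ with $1\le j\le N-2$, $\frac{A_0}{2}\le\mathrm{Area}(\triangle P_jP_{j+1}P_{j+2})$; (b) for each $j$ with $1\le j\le N-2$ the points $P_j,P_{j+1},P_{j+2}$ lie on a circle of radius $\ge R_0$. Then $$N<2+\frac{\mathrm{Length}(\mathcal C)}{(A_0R_0)^{1/3}}.$$ -}

module Defs where

open import Algebra.Bundles using (CommutativeRing)
import Algebra.Properties.Ring as RingProperties
import Algebra.Properties.Monoid.Sum as MonoidSum
import Algebra.Properties.Semiring.Exp as SemiringExp
import Algebra.Properties.Semiring.Mult as SemiringMult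
open import Data.Fin.Base using (Fin; toℕ; inject₁) renaming (suc to fsuc; _<_ to _<ᶠ_; _≤_ to _≤ᶠ_)
open import Data.Maybe.Base using (map)
open import Data.Nat.Base using (ℕ; zero; suc; NonZero)
open import Data.Product.Base using (_×_; _,_; ∃; ∃-syntax; Σ-syntax)
open import Data.Sum.Base using (_⊎_; inj₁; inj₂)
open import Level using (0ℓ) renaming (suc to lsuc)
open import Relation.Binary.Core using (Rel)
open import Relation.Binary.PropositionalEquality.Core using (_≡_; _≢_)
open import Relation.Binary.Structures using (IsDecTotalOrder)
import Relation.Binary.Construct.Add.Supremum.NonStrict as AddSupremumNonStrict
import Relation.Binary.Construct.Add.Supremum.Strict as AddSupremumStrict
import Relation.Binary.Construct.NonStrictToStrict as NonStrictToStrict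
open import Relation.Nullary.Construct.Add.Supremum using (_⁺; [_])
open import Relation.Nullary.Decidable.Core using (yes; no)
open import Relation.Nullary.Negation.Core using (¬_)
open import Relation.Unary using (Pred)

-- The real numbers, characterised (classically: up to unique isomorphism) as a
-- Dedekind-complete ordered field.  As usual in classical analysis the order is
-- decidable.  The value of 0# ⁻¹ is unspecified.
record RealNumbers : Set (lsuc 0ℓ) where
  infix 4 _≤_
  infix 8 _⁻¹
  field
    commutativeRing : CommutativeRing 0ℓ 0ℓ

  open CommutativeRing commutativeRing public renaming (Carrier to ℝ)
    hiding (zero)

  field
    _≤_             : Rel ℝ 0ℓ
    isDecTotalOrder : IsDecTotalOrder _≈_ _≤_

    0≉1         : ¬ (0# ≈ 1#)
    _⁻¹         : ℝ → ℝ
    ⁻¹-cong     : ∀ {x y} → x ≈ y → x ⁻¹ ≈ y ⁻¹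
    ⁻¹-inverseʳ : ∀ x → ¬ (x ≈ 0#) → x * x ⁻¹ ≈ 1#

    +-monoʳ-≤ : ∀ z {x y} → x ≤ y → z + x ≤ z + y
    *-nonNeg  : ∀ {x y} → 0# ≤ x → 0# ≤ y → 0# ≤ x * y

  IsUpperBound : Pred ℝ 0ℓ → ℝ → Set
  IsUpperBound S u = ∀ {x} → S x → x ≤ u

  field
    sup       : (S : Pred ℝ 0ℓ) → ∃ S → ∃ (IsUpperBound S) → ℝ
    sup-upper : ∀ S ne bd → IsUpperBound S (sup S ne bd)
    sup-least : ∀ S ne bd {u} → IsUpperBound S u → sup S ne bd ≤ u

module RealPlane (reals : RealNumbers) where

  open RealNumbers reals public
  open IsDecTotalOrder isDecTotalOrder public
    using (_≤?_; total; ≤-respˡ-≈; ≤-respʳ-≈)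
    renaming (refl to ≤-refl; reflexive to ≤-reflexive; trans to ≤-trans)
  open NonStrictToStrict _≈_ _≤_ public using (_<_)
  open AddSupremumNonStrict _≤_ public using (_≤⁺_)
  open AddSupremumStrict _<_ public using (_<⁺_)
  open SemiringExp semiring public using (_^_)
  open MonoidSum +-monoid public using (sum)
  open SemiringMult semiring using () renaming (_×_ to _·_)
  open RingProperties ring using (-‿distribˡ-*; -‿distribʳ-*; -‿involutive)

  infixl 7 _/_
  _/_ : ℝ → ℝ → ℝ
  x / y = x * y ⁻¹

  fromℕ : ℕ → ℝ
  fromℕ n = n · 1#

  ∣_∣ : ℝ → ℝ
  ∣ x ∣ with 0# ≤? x
  ... | yes _ = x
  ... | no  _ = - x

  private
    ≤⇒0≤- : ∀ {x y} → x ≤ y → 0# ≤ y - x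
    ≤⇒0≤- {x} {y} p = ≤-respˡ-≈ (-‿inverseˡ x)
      (≤-respʳ-≈ (+-comm (- x) y) (+-monoʳ-≤ (- x) p))

    0≤-⇒≤ : ∀ {x y} → 0# ≤ y - x → x ≤ y
    0≤-⇒≤ {x} {y} p = ≤-respˡ-≈ (+-identityʳ x) (≤-respʳ-≈ eq (+-monoʳ-≤ x p))
      where
      eq : x + (y - x) ≈ y
      eq = trans (+-congˡ (+-comm y (- x)))
             (trans (sym (+-assoc x (- x) y))
               (trans (+-congʳ (-‿inverseʳ x)) (+-identityˡ y)))

    0≤1 : 0# ≤ 1#
    0≤1 with total 0# 1#
    ... | inj₁ p = p
    ... | inj₂ p = ≤-respʳ-≈ eq (*-nonNeg q q)
      where
      q : 0# ≤ - 1#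
      q = ≤-respʳ-≈ (+-identityˡ (- 1#)) (≤⇒0≤- p)
      eq : - 1# * - 1# ≈ 1#
      eq = trans (sym (-‿distribˡ-* 1# (- 1#)))
             (trans (-‿cong (*-identityˡ (- 1#))) (-‿involutive 1#))

    *-monoʳ-≤ : ∀ {x y z} → 0# ≤ z → x ≤ y → z * x ≤ z * y
    *-monoʳ-≤ {x} {y} {z} 0≤z x≤y = 0≤-⇒≤ (≤-respʳ-≈ eq (*-nonNeg 0≤z (≤⇒0≤- x≤y)))
      where
      eq : z * (y - x) ≈ z * y - z * x
      eq = trans (distribˡ z y (- x)) (+-congˡ (sym (-‿distribʳ-* z x)))

    x≤x*y : ∀ {x y} → 0# ≤ x → 1# ≤ y → x ≤ x * y
    x≤x*y {x} 0≤x 1≤y = ≤-respˡ-≈ (*-identityʳ x) (*-monoʳ-≤ 0≤x 1≤y)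

    1≤x^n : ∀ {x} n → 1# ≤ x → 1# ≤ x ^ n
    1≤x^n zero    1≤x = ≤-refl
    1≤x^n (suc n) 1≤x =
      ≤-trans 1≤x (x≤x*y (≤-trans 0≤1 1≤x) (1≤x^n n 1≤x))

  -- The nonnegative n-th root of x ≥ 0 is sup { y ≥ 0 ∣ yⁿ ≤ x }.  The point 0 is
  -- always included, so that the root is total, with value 0 when x < 0.
  RootSet : ℕ → ℝ → Pred ℝ 0ℓ
  RootSet n x y = (y ≈ 0#) ⊎ (0# ≤ y × y ^ n ≤ x)

  RootSet-bounded : ∀ n .{{_ : NonZero n}} x → ∃ (IsUpperBound (RootSet n x))
  RootSet-bounded (suc n) x with total 1# x
  ... | inj₁ 1≤x = x , λ
    { (inj₁ y≈0)          → ≤-trans (≤-reflexive y≈0) (≤-trans 0≤1 1≤x)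
    ; (inj₂ (0≤y , yⁿ≤x)) → bound 0≤y yⁿ≤x }
    where
    bound : ∀ {y} → 0# ≤ y → y ^ suc n ≤ x → y ≤ x
    bound {y} 0≤y yⁿ≤x with total 1# y
    ... | inj₁ 1≤y = ≤-trans (x≤x*y 0≤y (1≤x^n n 1≤y)) yⁿ≤x
    ... | inj₂ y≤1 = ≤-trans y≤1 1≤x
  ... | inj₂ x≤1 = 1# , λ
    { (inj₁ y≈0)          → ≤-trans (≤-reflexive y≈0) 0≤1
    ; (inj₂ (0≤y , yⁿ≤x)) → bound 0≤y yⁿ≤x }
    where
    bound : ∀ {y} → 0# ≤ y → y ^ suc n ≤ x → y ≤ 1#
    bound {y} 0≤y yⁿ≤x with total 1# y
    ... | inj₁ 1≤y = ≤-trans (≤-trans (x≤x*y 0≤y (1≤x^n n 1≤y)) yⁿ≤x) x≤1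
    ... | inj₂ y≤1 = y≤1

  root : ∀ n .{{_ : NonZero n}} → ℝ → ℝ
  root n x = sup (RootSet n x) (0# , inj₁ refl) (RootSet-bounded n x)

  Point : Set
  Point = ℝ × ℝ

  infix 4 _≈ₚ_
  _≈ₚ_ : Rel Point 0ℓ
  (x₁ , y₁) ≈ₚ (x₂ , y₂) = x₁ ≈ x₂ × y₁ ≈ y₂

  dist : Point → Point → ℝ
  dist (x₁ , y₁) (x₂ , y₂) = root 2 ((x₁ - x₂) ^ 2 + (y₁ - y₂) ^ 2)

  triangleArea : Point → Point → Point → ℝ
  triangleArea (x₁ , y₁) (x₂ , y₂) (x₃ , y₃) =
    ∣ (x₂ - x₁) * (y₃ - y₁) - (x₃ - x₁) * (y₂ - y₁) ∣ / fromℕ 2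

  OnCircle : Point → ℝ → Pred Point 0ℓ
  OnCircle centre r P = dist centre P ≈ r

  record IsInterval (I : Pred ℝ 0ℓ) : Set where
    field
      convex        : ∀ {a b t} → I a → I b → a ≤ t → t ≤ b → I t
      nondegenerate : ∃[ a ] ∃[ b ] I a × I b × a < b

  -- Functions on I are represented by functions on ℝ whose values off I are
  -- irrelevant.  Both notions below force f to respect _≈_ on I.
  ContinuousOn : Pred ℝ 0ℓ → (ℝ → ℝ) → Set
  ContinuousOn I f = ∀ {t} → I t → ∀ {ε} → 0# < ε →
    ∃[ δ ] 0# < δ × (∀ {s} → I s → ∣ s - t ∣ < δ → ∣ f s - f t ∣ < ε)

  HasDerivativeOn : Pred ℝ 0ℓ → (ℝ → ℝ) → (ℝ → ℝ) → Set
  HasDerivativeOn I f f′ = ∀ {t} → I t → ∀ {ε} → 0# < ε →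
    ∃[ δ ] 0# < δ × (∀ {s} → I s → ∣ s - t ∣ < δ →
      ∣ (f s - f t) - f′ t * (s - t) ∣ ≤ ε * ∣ s - t ∣)

  -- A C¹ immersion of an arbitrary (open, closed, half-open, unbounded)
  -- nondegenerate interval in the plane; it need not be injective.
  record ImmersedCurve : Set (lsuc 0ℓ) where
    field
      Domain     : Pred ℝ 0ℓ
      isInterval : IsInterval Domain
      x y x′ y′  : ℝ → ℝ
      x-deriv    : HasDerivativeOn Domain x x′
      y-deriv    : HasDerivativeOn Domain y y′
      x′-cont    : ContinuousOn Domain x′
      y′-cont    : ContinuousOn Domain y′
      immersed   : ∀ {t} → Domain t → ¬ (x′ t ≈ 0# × y′ t ≈ 0#)

    γ : ℝ → Point
    γ t = x t , y t

  module _ (C : ImmersedCurve) where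
    open ImmersedCurve C

    InscribedLength : Pred ℝ 0ℓ
    InscribedLength ℓ = ∃[ n ] Σ[ t ∈ (Fin (suc n) → ℝ) ]
        (∀ i → Domain (t i))
      × (∀ i j → i ≤ᶠ j → t i ≤ t j)
      × ℓ ≈ sum {n} (λ i → dist (γ (t (inject₁ i))) (γ (t (fsuc i))))

    -- Arc length is the supremum, in ℝ ∪ {+∞}, of the lengths of the inscribed
    -- polygons.
    IsLength : Pred (ℝ ⁺) 0ℓ
    IsLength L = (∀ {ℓ} → InscribedLength ℓ → [ ℓ ] ≤⁺ L)
               × (∀ {U} → (∀ {ℓ} → InscribedLength ℓ → [ ℓ ] ≤⁺ U) → L ≤⁺ U)

    InOrderAlong : ∀ {N} → (Fin N → Point) → Set
    InOrderAlong {N} P = Σ[ t ∈ (Fin N → ℝ) ]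
        (∀ i → Domain (t i))
      × (∀ i j → i <ᶠ j → t i < t j)
      × (∀ i → P i ≈ₚ γ (t i))

  Distinct : ∀ {N} → (Fin N → Point) → Set
  Distinct P = ∀ i j → i ≢ j → ¬ (P i ≈ₚ P j)

  Consecutive : ∀ {N} → Fin N → Fin N → Fin N → Set
  Consecutive i j k = (toℕ j ≡ suc (toℕ i)) × (toℕ k ≡ suc (toℕ j))

  infixl 6 _+⁺_
  _+⁺_ : ℝ → ℝ ⁺ → ℝ ⁺
  x +⁺ L = map (x +_) L

  -- Only used for c > 0, so that ∞ / c = ∞.
  infixl 7 _/⁺_
  _/⁺_ : ℝ ⁺ → ℝ → ℝ ⁺
  L /⁺ c = map (_/ c) L

{-# OPTIONS --safe #-}
module Submission where

-- Write aⱼ = |PⱼPⱼ₊₁|.  The circumradius formula for the triangle PⱼPⱼ₊₁Pⱼ₊₂, the triangle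
-- inequality and AM-GM give 8A₀R₀ ≤ (aⱼ + aⱼ₊₁)³, i.e. aⱼ + aⱼ₊₁ ≥ 2(A₀R₀)^(1/3).  Summing
-- over j counts every chord at most twice and the first and last one only once, so
-- 2(N - 2)(A₀R₀)^(1/3) < 2 ∑ aⱼ ≤ 2 Length(C).

open import Defs
open import Algebra.Bundles using (CommutativeRing)
import Algebra.Properties.Ring as RingProperties
import Algebra.Properties.Semiring.Exp as SemiringExp
import Algebra.Properties.Semiring.Mult as SemiringMult
import Algebra.Solver.Ring as RingSolver
open import Algebra.Solver.Ring.AlmostCommutativeRing using (AlmostCommutativeRing; fromCommutativeRing; _-Raw-AlmostCommutative⟶_; Induced-equivalence)
open import Data.Fin.Base using (Fin; inject₁) renaming (zero to fzero; suc to fsuc; _<_ to _<ᶠ_; _≤_ to _≤ᶠ_)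
import Data.Fin.Properties as Fin
open import Data.Integer.Base as ℤ using (ℤ; +_; -[1+_])
import Data.Integer.Properties as ℤ
open import Data.Maybe.Base using (just; nothing)
open import Data.Nat.Base as ℕ using (ℕ; zero; suc)
import Data.Nat.Properties as ℕ
open import Data.Product.Base using (_×_; _,_; proj₁; proj₂; ∃-syntax)
open import Data.Sum.Base using (inj₁; inj₂)
import Relation.Binary.Construct.Add.Supremum.NonStrict as AddSupremumNonStrict
import Relation.Binary.Construct.Add.Supremum.Strict as AddSupremumStrict
import Relation.Binary.Construct.NonStrictToStrict as NonStrictToStrict
open import Relation.Binary.Definitions using (WeaklyDecidable)
import Relation.Binary.PropositionalEquality.Core as ≡
import Relation.Binary.Reasoning.Setoid as SetoidReasoning
open import Relation.Binary.Structures using (IsDecTotalOrder)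
open import Relation.Nullary.Construct.Add.Supremum using (_⁺; [_]; ⊤⁺)
open import Relation.Nullary.Decidable.Core using (yes; no)
open import Relation.Nullary.Negation.Core using (¬_; contradiction)

-- Ring solver with integer coefficients.

module IntegerCoefficientSolver {c ℓ} (R : CommutativeRing c ℓ) where

  open CommutativeRing R hiding (zero)
  open RingProperties ring using (-‿distribˡ-*; -‿distribʳ-*; -‿involutive; -0#≈0#; -‿+-comm)
  open SemiringMult semiring using (×-homo-+; ×1-homo-*) renaming (_×_ to _·_)
  open SetoidReasoning setoid

  -- On nonnegative integers this unfolds to the same expression as `fromℕ`, so a solver numeral
  -- `con (+ 2)` matches `fromℕ 2` in a goal definitionally.
  fromℤ : ℤ → Carrier
  fromℤ (+ n)    = n · 1#
  fromℤ -[1+ n ] = - (suc n · 1#)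

  fromℤ-neg : ∀ i → fromℤ (ℤ.- i) ≈ - fromℤ i
  fromℤ-neg (+ zero)  = sym -0#≈0#
  fromℤ-neg (+ suc n) = refl
  fromℤ-neg -[1+ n ]  = sym (-‿involutive _)

  fromℤ-⊖ : ∀ m n → fromℤ (m ℤ.⊖ n) ≈ m · 1# - n · 1#
  fromℤ-⊖ m zero = sym (trans (+-congˡ -0#≈0#) (+-identityʳ _))
  fromℤ-⊖ zero (suc n) = sym (+-identityˡ _)
  fromℤ-⊖ (suc m) (suc n) = begin
    fromℤ (suc m ℤ.⊖ suc n)                      ≡⟨ ≡.cong fromℤ (ℤ.[1+m]⊖[1+n]≡m⊖n m n) ⟩
    fromℤ (m ℤ.⊖ n)                              ≈⟨ fromℤ-⊖ m n ⟩
    m · 1# - n · 1#                              ≈⟨ +-congʳ (+-identityʳ _) ⟨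
    (m · 1# + 0#) - n · 1#                       ≈⟨ +-congʳ (+-congˡ (-‿inverseʳ 1#)) ⟨
    (m · 1# + (1# - 1#)) - n · 1#                ≈⟨ +-congʳ (+-assoc _ _ _) ⟨
    ((m · 1# + 1#) - 1#) - n · 1#                ≈⟨ +-assoc _ _ _ ⟩
    (m · 1# + 1#) + (- 1# - n · 1#)              ≈⟨ +-cong (+-comm _ _) (-‿+-comm _ _) ⟩
    (1# + m · 1#) - (1# + n · 1#)                ∎

  fromℤ-+ : ∀ i j → fromℤ (i ℤ.+ j) ≈ fromℤ i + fromℤ j
  fromℤ-+ (+ m)    (+ n)    = ×-homo-+ 1# m n
  fromℤ-+ (+ m)    -[1+ n ] = fromℤ-⊖ m (suc n)
  fromℤ-+ -[1+ m ] (+ n)    = trans (fromℤ-⊖ n (suc m)) (+-comm _ _)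
  fromℤ-+ -[1+ m ] -[1+ n ] = begin
    - (suc (suc (m ℕ.+ n)) · 1#)        ≈⟨ -‿cong (+-congˡ (×-homo-+ 1# (suc m) n)) ⟩
    - (1# + (suc m · 1# + n · 1#))      ≈⟨ -‿cong (+-assoc _ _ _) ⟨
    - ((1# + suc m · 1#) + n · 1#)      ≈⟨ -‿cong (+-congʳ (+-comm _ _)) ⟩
    - ((suc m · 1# + 1#) + n · 1#)      ≈⟨ -‿cong (+-assoc _ _ _) ⟩
    - (suc m · 1# + suc n · 1#)         ≈⟨ -‿+-comm _ _ ⟨
    - (suc m · 1#) - (suc n · 1#)       ∎

  -- With a natural number on the right, only the sign of `i` has to be pulled out; `fromℤ-*` then
  -- treats the sign of the right factor in the same way.
  fromℤ-*-pos : ∀ i n → fromℤ (i ℤ.* (+ n)) ≈ fromℤ i * (n · 1#)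
  fromℤ-*-pos (+ m) n = begin
    fromℤ ((+ m) ℤ.* (+ n)) ≡⟨ ≡.cong fromℤ (ℤ.pos-* m n) ⟨
    (m ℕ.* n) · 1#          ≈⟨ ×1-homo-* m n ⟩
    (m · 1#) * (n · 1#)     ∎
  fromℤ-*-pos -[1+ m ] n = begin
    fromℤ (-[1+ m ] ℤ.* (+ n))        ≡⟨ ≡.cong fromℤ (ℤ.neg-distribˡ-* (+ suc m) (+ n)) ⟨
    fromℤ (ℤ.- ((+ suc m) ℤ.* (+ n))) ≈⟨ fromℤ-neg ((+ suc m) ℤ.* (+ n)) ⟩
    - fromℤ ((+ suc m) ℤ.* (+ n))     ≈⟨ -‿cong (fromℤ-*-pos (+ suc m) n) ⟩
    - ((suc m · 1#) * (n · 1#))       ≈⟨ -‿distribˡ-* _ _ ⟩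
    - (suc m · 1#) * (n · 1#)         ∎

  fromℤ-* : ∀ i j → fromℤ (i ℤ.* j) ≈ fromℤ i * fromℤ j
  fromℤ-* i (+ n)    = fromℤ-*-pos i n
  fromℤ-* i -[1+ n ] = begin
    fromℤ (i ℤ.* -[1+ n ])        ≡⟨ ≡.cong fromℤ (ℤ.neg-distribʳ-* i (+ suc n)) ⟨
    fromℤ (ℤ.- (i ℤ.* (+ suc n))) ≈⟨ fromℤ-neg (i ℤ.* (+ suc n)) ⟩
    - fromℤ (i ℤ.* (+ suc n))     ≈⟨ -‿cong (fromℤ-*-pos i (suc n)) ⟩
    - (fromℤ i * (suc n · 1#))    ≈⟨ -‿distribʳ-* _ _ ⟩
    fromℤ i * - (suc n · 1#)      ∎

  almostCommutativeRing : AlmostCommutativeRing c ℓ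
  almostCommutativeRing = fromCommutativeRing R

  fromℤ-morphism : ℤ.+-*-rawRing -Raw-AlmostCommutative⟶ almostCommutativeRing
  fromℤ-morphism = record
    { ⟦_⟧    = fromℤ
    ; +-homo = fromℤ-+
    ; *-homo = fromℤ-*
    ; -‿homo = fromℤ-neg
    ; 0-homo = refl
    ; 1-homo = +-identityʳ 1#
    }

  fromℤ-≟ : WeaklyDecidable (Induced-equivalence fromℤ-morphism)
  fromℤ-≟ i j with i ℤ.≟ j
  ... | yes ≡.refl = just refl
  ... | no  _      = nothing

  open RingSolver ℤ.+-*-rawRing almostCommutativeRing fromℤ-morphism fromℤ-≟ public
    using (solve; con; _:=_; _:+_; _:*_; _:-_; :-_; _:^_)

-- Inequalities in an ordered field.

module OrderedField (reals : RealNumbers) where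

  open RealPlane reals
  open IsDecTotalOrder isDecTotalOrder using (_≟_; antisym)
  open IntegerCoefficientSolver commutativeRing
  open SemiringExp semiring using (^-congˡ)
  private module Strict = NonStrictToStrict _≈_ _≤_

  ≰⇒> : ∀ {x y} → ¬ (x ≤ y) → y < x
  ≰⇒> = Strict.≰⇒> sym ≤-reflexive total

  <⇒≱ : ∀ {x y} → x < y → ¬ (y ≤ x)
  <⇒≱ = Strict.<⇒≱ antisym

  <-≤-trans : ∀ {x y z} → x < y → y ≤ z → x < z
  <-≤-trans = Strict.<-≤-trans sym ≤-trans antisym ≤-respʳ-≈

  ≤-<-trans : ∀ {x y z} → x ≤ y → y < z → x < z
  ≤-<-trans = Strict.≤-<-trans ≤-trans antisym ≤-respˡ-≈

  <-resp-≈ : ∀ {x x′ y y′} → x ≈ x′ → y ≈ y′ → x < y → x′ < y′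
  <-resp-≈ x≈x′ y≈y′ x<y = ≤-<-trans (≤-reflexive (sym x≈x′)) (<-≤-trans x<y (≤-reflexive y≈y′))

  ≤-resp-≈ : ∀ {x x′ y y′} → x ≈ x′ → y ≈ y′ → x ≤ y → x′ ≤ y′
  ≤-resp-≈ x≈x′ y≈y′ x≤y = ≤-respˡ-≈ x≈x′ (≤-respʳ-≈ y≈y′ x≤y)

  ≤⇒0≤- : ∀ {x y} → x ≤ y → 0# ≤ y - x
  ≤⇒0≤- {x} {y} x≤y = ≤-resp-≈ (-‿inverseˡ x) (+-comm (- x) y) (+-monoʳ-≤ (- x) x≤y)

  0≤-⇒≤ : ∀ {x y} → 0# ≤ y - x → x ≤ y
  0≤-⇒≤ {x} {y} 0≤y-x = ≤-resp-≈ (+-identityʳ x)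
    (solve 2 (λ x y → x :+ (y :- x) := y) refl x y) (+-monoʳ-≤ x 0≤y-x)

  -- Reduces an inequality to a polynomial identity: the gap is exhibited as a visibly nonnegative
  -- `d`, typically built from a square, and the ring solver checks the equation.
  ≤-by-gap : ∀ {x y d} → 0# ≤ d → d ≈ y - x → x ≤ y
  ≤-by-gap 0≤d d≈y-x = 0≤-⇒≤ (≤-respʳ-≈ d≈y-x 0≤d)

  +-mono-≤ : ∀ {w x y z} → w ≤ x → y ≤ z → w + y ≤ x + z
  +-mono-≤ {w} {x} {y} {z} w≤x y≤z =
    ≤-trans (+-monoʳ-≤ w y≤z) (≤-resp-≈ (+-comm z w) (+-comm z x) (+-monoʳ-≤ z w≤x))

  +-monoʳ-< : ∀ z {x y} → x < y → z + x < z + y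
  +-monoʳ-< z {x} {y} x<y = ≰⇒> λ z+y≤z+x → <⇒≱ x<y
    (≤-resp-≈ (eq y) (eq x) (+-monoʳ-≤ (- z) z+y≤z+x))
    where
    eq : ∀ w → - z + (z + w) ≈ w
    eq w = solve 2 (λ z w → :- z :+ (z :+ w) := w) refl z w

  +-nonNeg : ∀ {x y} → 0# ≤ x → 0# ≤ y → 0# ≤ x + y
  +-nonNeg 0≤x 0≤y = ≤-respˡ-≈ (+-identityˡ 0#) (+-mono-≤ 0≤x 0≤y)

  0<x⇒0<x+y : ∀ {x y} → 0# < x → 0# ≤ y → 0# < x + y
  0<x⇒0<x+y 0<x 0≤y = <-≤-trans 0<x (≤-respˡ-≈ (+-identityʳ _) (+-monoʳ-≤ _ 0≤y))

  *-monoʳ-≤ : ∀ {x y z} → 0# ≤ z → x ≤ y → z * x ≤ z * y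
  *-monoʳ-≤ {x} {y} {z} 0≤z x≤y = 0≤-⇒≤ (≤-respʳ-≈
    (solve 3 (λ x y z → z :* (y :- x) := z :* y :- z :* x) refl x y z)
    (*-nonNeg 0≤z (≤⇒0≤- x≤y)))

  *-mono-≤ : ∀ {w x y z} → 0# ≤ w → 0# ≤ z → w ≤ x → y ≤ z → w * y ≤ x * z
  *-mono-≤ 0≤w 0≤z w≤x y≤z = ≤-trans (*-monoʳ-≤ 0≤w y≤z)
    (≤-resp-≈ (*-comm _ _) (*-comm _ _) (*-monoʳ-≤ 0≤z w≤x))

  0≤x^2 : ∀ x → 0# ≤ x ^ 2
  0≤x^2 x with total 0# x
  ... | inj₁ 0≤x = ≤-respʳ-≈ (*-congˡ (sym (*-identityʳ x))) (*-nonNeg 0≤x 0≤x)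
  ... | inj₂ x≤0 = ≤-respʳ-≈ (solve 1 (λ x → (con (+ 0) :- x) :* (con (+ 0) :- x) := x :^ 2) refl x)
                     (*-nonNeg (≤⇒0≤- x≤0) (≤⇒0≤- x≤0))

  0<1 : 0# < 1#
  0<1 = ≤-respʳ-≈ (trans (*-identityˡ _) (*-identityˡ _)) (0≤x^2 1#) , 0≉1

  >⇒≉ : ∀ {x} → 0# < x → ¬ (x ≈ 0#)
  >⇒≉ (_ , 0≉x) x≈0 = 0≉x (sym x≈0)

  x*[y/x]≈y : ∀ {x} → 0# < x → ∀ y → x * (y / x) ≈ y
  x*[y/x]≈y {x} 0<x y = begin
    x * (y * x ⁻¹) ≈⟨ solve 3 (λ x y z → x :* (y :* z) := y :* (x :* z)) refl x y (x ⁻¹) ⟩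
    y * (x * x ⁻¹) ≈⟨ *-congˡ (⁻¹-inverseʳ x (>⇒≉ 0<x)) ⟩
    y * 1#         ≈⟨ *-identityʳ y ⟩
    y              ∎
    where open SetoidReasoning setoid

  0<x⇒0≤x⁻¹ : ∀ {x} → 0# < x → 0# ≤ x ⁻¹
  0<x⇒0≤x⁻¹ {x} 0<x with total 0# (x ⁻¹)
  ... | inj₁ 0≤x⁻¹ = 0≤x⁻¹
  ... | inj₂ x⁻¹≤0 = contradiction
    (≤-resp-≈ (⁻¹-inverseʳ x (>⇒≉ 0<x)) (zeroʳ x) (*-monoʳ-≤ (proj₁ 0<x) x⁻¹≤0)) (<⇒≱ 0<1)

  *-cancelˡ-≤ : ∀ {x y z} → 0# < z → z * x ≤ z * y → x ≤ y
  *-cancelˡ-≤ {x} {y} {z} 0<z zx≤zy =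
    ≤-resp-≈ (eq x) (eq y) (*-monoʳ-≤ (0<x⇒0≤x⁻¹ 0<z) zx≤zy)
    where
    eq : ∀ w → z ⁻¹ * (z * w) ≈ w
    eq w = trans (solve 3 (λ i z w → i :* (z :* w) := z :* (w :* i)) refl (z ⁻¹) z w)
                 (x*[y/x]≈y 0<z w)

  *-cancelˡ-< : ∀ {x y z} → 0# ≤ z → z * x < z * y → x < y
  *-cancelˡ-< 0≤z zx<zy = ≰⇒> λ y≤x → <⇒≱ zx<zy (*-monoʳ-≤ 0≤z y≤x)

  *-pos : ∀ {x y} → 0# < x → 0# < y → 0# < x * y
  *-pos {x} {y} 0<x 0<y = ≰⇒> λ xy≤0 →
    <⇒≱ 0<y (*-cancelˡ-≤ 0<x (≤-respʳ-≈ (sym (zeroʳ x)) xy≤0))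

  /-nonNeg : ∀ {x y} → 0# ≤ x → 0# < y → 0# ≤ x / y
  /-nonNeg 0≤x 0<y = *-nonNeg 0≤x (0<x⇒0≤x⁻¹ 0<y)

  fromℕ-nonNeg : ∀ n → 0# ≤ fromℕ n
  fromℕ-nonNeg zero    = ≤-refl
  fromℕ-nonNeg (suc n) = +-nonNeg (proj₁ 0<1) (fromℕ-nonNeg n)

  fromℕ-pos : ∀ n → 0# < fromℕ (suc n)
  fromℕ-pos n = 0<x⇒0<x+y 0<1 (fromℕ-nonNeg n)

  ^-nonNeg : ∀ {x} n → 0# ≤ x → 0# ≤ x ^ n
  ^-nonNeg zero    0≤x = proj₁ 0<1
  ^-nonNeg (suc n) 0≤x = *-nonNeg 0≤x (^-nonNeg n 0≤x)

  ^-pos : ∀ {x} n → 0# < x → 0# < x ^ n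
  ^-pos zero    0<x = 0<1
  ^-pos (suc n) 0<x = *-pos 0<x (^-pos n 0<x)

  ^-mono-≤ : ∀ {x y} n → 0# ≤ x → x ≤ y → x ^ n ≤ y ^ n
  ^-mono-≤ zero    0≤x x≤y = ≤-refl
  ^-mono-≤ (suc n) 0≤x x≤y =
    *-mono-≤ 0≤x (^-nonNeg n (≤-trans 0≤x x≤y)) x≤y (^-mono-≤ n 0≤x x≤y)

  ^-cancel-≤ : ∀ {x y} n → 0# ≤ y → x ^ suc n ≤ y ^ suc n → x ≤ y
  ^-cancel-≤ {x} {y} n 0≤y xⁿ≤yⁿ with x ≤? y
  ... | yes x≤y = x≤y
  -- Here `y < x`, so `x ^ suc n ≤ y ^ suc n ≤ y * x ^ n`; cancelling the positive `x ^ n` gives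
  -- `x ≤ y` in this branch too.
  ... | no  x≰y = *-cancelˡ-≤ (^-pos n (≤-<-trans 0≤y y<x))
      (≤-resp-≈ (*-comm _ _) (*-comm _ _)
        (≤-trans xⁿ≤yⁿ (*-monoʳ-≤ 0≤y (^-mono-≤ n 0≤y (proj₁ y<x)))))
    where
    y<x : y < x
    y<x = ≰⇒> x≰y

  -- Comparing with the square of 0 gives `x ≤ 0#`; the same argument for `- x`, which has the same
  -- square, gives the reverse inequality.
  x^2≤0⇒x≈0 : ∀ {x} → x ^ 2 ≤ 0# → x ≈ 0#
  x^2≤0⇒x≈0 {x} x²≤0 = antisym (nonPos x²≤0) (0≤-⇒≤ (≤-respʳ-≈ eq (≤⇒0≤- (nonPos
    (≤-respˡ-≈ (solve 1 (λ x → x :^ 2 := (:- x) :^ 2) refl x) x²≤0)))))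
    where
    nonPos : ∀ {y} → y ^ 2 ≤ 0# → y ≤ 0#
    nonPos y²≤0 = ^-cancel-≤ 1 ≤-refl (≤-respʳ-≈ (sym (zeroˡ _)) y²≤0)
    eq : 0# - - x ≈ x - 0#
    eq = solve 1 (λ x → con (+ 0) :- (:- x) := x :- con (+ 0)) refl x

  ∣x∣^2≈x^2 : ∀ x → ∣ x ∣ ^ 2 ≈ x ^ 2
  ∣x∣^2≈x^2 x with 0# ≤? x
  ... | yes _ = refl
  ... | no  _ = solve 1 (λ x → (:- x) :^ 2 := x :^ 2) refl x

  -- Roots as suprema.

  root-nonNeg : ∀ n .{{_ : ℕ.NonZero n}} x → 0# ≤ root n x
  root-nonNeg n x = sup-upper (RootSet n x) _ _ (inj₁ refl)

  root-upper : ∀ n .{{_ : ℕ.NonZero n}} {x y} → 0# ≤ y → y ^ n ≤ x → y ≤ root n x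
  root-upper n {x} 0≤y yⁿ≤x = sup-upper (RootSet n x) _ _ (inj₂ (0≤y , yⁿ≤x))

  -- A member `z` of the root set with `z ^ suc n ≤ x` has `z ^ suc n ≤ y ^ suc n`, and the exponent
  -- cancels; the extra member 0 is covered by `0# ≤ y`. The cube root of `A₀ * R₀` is later bounded
  -- above in this way, by comparing cubes.
  root-least : ∀ n {x y} → 0# ≤ y → x ≤ y ^ suc n → root (suc n) x ≤ y
  root-least n {x} {y} 0≤y x≤yⁿ = sup-least (RootSet (suc n) x) _ _ λ
    { (inj₁ z≈0)          → ≤-respˡ-≈ (sym z≈0) 0≤y
    ; (inj₂ (_ , zⁿ≤x)) → ^-cancel-≤ n 0≤y (≤-trans zⁿ≤x x≤yⁿ) }

  x^[1+n]≤x : ∀ {x} n → 0# ≤ x → x ≤ 1# → x ^ suc n ≤ x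
  x^[1+n]≤x zero    0≤x x≤1 = ≤-reflexive (*-identityʳ _)
  x^[1+n]≤x (suc n) 0≤x x≤1 =
    ≤-trans (*-monoʳ-≤ 0≤x (≤-trans (x^[1+n]≤x n 0≤x x≤1) x≤1)) (≤-reflexive (*-identityʳ _))

  -- The smaller of `x` and 1 is positive, and its power is at most `x`, so it lies in the root set.
  root-pos : ∀ n {x} → 0# < x → 0# < root (suc n) x
  root-pos n {x} 0<x with total x 1#
  ... | inj₁ x≤1 = <-≤-trans 0<x (root-upper (suc n) (proj₁ 0<x) (x^[1+n]≤x n (proj₁ 0<x) x≤1))
  ... | inj₂ 1≤x = <-≤-trans 0<1 (root-upper (suc n) (proj₁ 0<1)
                     (≤-trans (x^[1+n]≤x n (proj₁ 0<1) ≤-refl) 1≤x))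

  -- For s = √x the Babylonian iterates t = (s² + x)/2s and u = x/t satisfy u² ≤ x ≤ t²,
  -- so u ≤ s ≤ t by the two halves of the supremum property, hence s² ≤ x and x ≤ s².
  root2-square : ∀ {x} → 0# ≤ x → root 2 x ^ 2 ≈ x
  root2-square {x} 0≤x with x ≟ 0#
  -- This case is separate because both denominators below, `fromℕ 2 * s` and `k`, vanish when `x`
  -- does.
  ... | yes x≈0 = trans (*-congʳ s≈0) (trans (zeroˡ _) (sym x≈0))
    where
    s≈0 : root 2 x ≈ 0#
    s≈0 = antisym (root-least 1 ≤-refl (≤-reflexive (trans x≈0 (sym (zeroˡ _))))) (root-nonNeg 2 x)
  ... | no x≉0 = antisym s²≤x x≤s²
    where
    s k t u : ℝ
    s = root 2 x
    k = s ^ 2 + x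
    t = k / (fromℕ 2 * s)
    u = (fromℕ 2 * x * s) / k

    0<x : 0# < x
    0<x = 0≤x , λ 0≈x → x≉0 (sym 0≈x)

    0<s : 0# < s
    0<s = root-pos 1 0<x

    0<2s : 0# < fromℕ 2 * s
    0<2s = *-pos (fromℕ-pos 1) 0<s

    0<k : 0# < k
    0<k = 0<x⇒0<x+y (^-pos 2 0<s) 0≤x

    2s*t≈k : fromℕ 2 * s * t ≈ k
    2s*t≈k = x*[y/x]≈y 0<2s k

    k*u≈2xs : k * u ≈ fromℕ 2 * x * s
    k*u≈2xs = x*[y/x]≈y 0<k _

    -- `t` and `u` are the arithmetic and harmonic means of `s` and `x / s`, whose geometric mean is
    -- the root sought. Cleared of denominators, the gap is `(s ^ 2 - x) ^ 2`, times `x` in the case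
    -- of `u`.
    x≤t² : x ≤ t ^ 2
    x≤t² = *-cancelˡ-≤ (^-pos 2 0<2s) (≤-respʳ-≈
      (trans (^-congˡ 2 (sym 2s*t≈k))
        (solve 2 (λ a t → (a :* t) :^ 2 := a :^ 2 :* t :^ 2) refl (fromℕ 2 * s) t))
      (≤-by-gap (0≤x^2 (s ^ 2 - x))
        (solve 2 (λ s x → (s :^ 2 :- x) :^ 2
                       := (s :^ 2 :+ x) :^ 2 :- (con (+ 2) :* s) :^ 2 :* x) refl s x)))

    u²≤x : u ^ 2 ≤ x
    u²≤x = *-cancelˡ-≤ (^-pos 2 0<k) (≤-respˡ-≈
      (trans (^-congˡ 2 (sym k*u≈2xs))
        (solve 2 (λ k u → (k :* u) :^ 2 := k :^ 2 :* u :^ 2) refl k u))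
      (≤-by-gap (*-nonNeg 0≤x (0≤x^2 (s ^ 2 - x)))
        (solve 2 (λ s x → x :* (s :^ 2 :- x) :^ 2
                       := (s :^ 2 :+ x) :^ 2 :* x :- (con (+ 2) :* x :* s) :^ 2) refl s x)))

    s≤t : s ≤ t
    s≤t = root-least 1 (/-nonNeg (proj₁ 0<k) 0<2s) x≤t²

    u≤s : u ≤ s
    u≤s = root-upper 2
      (/-nonNeg (proj₁ (*-pos (*-pos (fromℕ-pos 1) 0<x) 0<s)) 0<k) u²≤x

    -- Multiplied by `2s`, the bound `s ≤ t` reads `2s² ≤ s² + x`; below, `u ≤ s` multiplied by `k`
    -- reads `2xs ≤ (s² + x)s`.
    s²≤x : s ^ 2 ≤ x
    s²≤x = ≤-by-gap (≤⇒0≤- (≤-respʳ-≈ 2s*t≈k (*-monoʳ-≤ (proj₁ 0<2s) s≤t)))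
      (solve 2 (λ s x → (s :^ 2 :+ x) :- con (+ 2) :* s :* s := x :- s :^ 2) refl s x)

    x≤s² : x ≤ s ^ 2
    x≤s² = *-cancelˡ-≤ 0<s (≤-by-gap
      (≤⇒0≤- (≤-respˡ-≈ k*u≈2xs (*-monoʳ-≤ (proj₁ 0<k) u≤s)))
      (solve 2 (λ s x → (s :^ 2 :+ x) :* s :- con (+ 2) :* x :* s
                     := s :* s :^ 2 :- s :* x) refl s x))

  -- Plane geometry: triangles and circumscribed circles.

  sqDist : Point → Point → ℝ
  sqDist (x₁ , y₁) (x₂ , y₂) = (x₁ - x₂) ^ 2 + (y₁ - y₂) ^ 2

  -- Twice the signed area of the triangle; `triangleArea` is half of its absolute value.
  det : Point → Point → Point → ℝ
  det (x₁ , y₁) (x₂ , y₂) (x₃ , y₃) = (x₂ - x₁) * (y₃ - y₁) - (x₃ - x₁) * (y₂ - y₁)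

  sqDist-nonNeg : ∀ A B → 0# ≤ sqDist A B
  sqDist-nonNeg A B = +-nonNeg (0≤x^2 _) (0≤x^2 _)

  sqDist-cong : ∀ {A A′ B B′} → A ≈ₚ A′ → B ≈ₚ B′ → sqDist A B ≈ sqDist A′ B′
  sqDist-cong (x , y) (x′ , y′) =
    +-cong (^-congˡ 2 (+-cong x (-‿cong x′))) (^-congˡ 2 (+-cong y (-‿cong y′)))

  dist-square : ∀ A B → dist A B ^ 2 ≈ sqDist A B
  dist-square A B = root2-square (sqDist-nonNeg A B)

  dist-nonNeg : ∀ A B → 0# ≤ dist A B
  dist-nonNeg A B = root-nonNeg 2 (sqDist A B)

  sqDist≤0⇒≈ₚ : ∀ A B → sqDist A B ≤ 0# → A ≈ₚ B
  sqDist≤0⇒≈ₚ A B d≤0 =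
      diff (≤-trans (≤-respˡ-≈ (+-identityʳ _) (+-monoʳ-≤ _ (0≤x^2 _))) d≤0)
    , diff (≤-trans (≤-respˡ-≈ (+-identityˡ _) (+-mono-≤ (0≤x^2 _) ≤-refl)) d≤0)
    where
    diff : ∀ {x y} → (x - y) ^ 2 ≤ 0# → x ≈ y
    diff {x} {y} [x-y]²≤0 = trans (solve 2 (λ x y → x := (x :- y) :+ y) refl x y)
      (trans (+-congʳ (x^2≤0⇒x≈0 [x-y]²≤0)) (+-identityˡ y))

  dist-pos : ∀ A B → ¬ (A ≈ₚ B) → 0# < dist A B
  dist-pos A B A≉B = root-pos 1 (≰⇒> λ d≤0 → A≉B (sqDist≤0⇒≈ₚ A B d≤0))

  -- The length of a side is passed together with its square, which lets the
  -- triangle inequality be used for points known only up to _≈ₚ_.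
  triangle-inequality : ∀ A B C {a b} → 0# ≤ a → 0# ≤ b →
    a ^ 2 ≈ sqDist A B → b ^ 2 ≈ sqDist B C → sqDist A C ≤ (a + b) ^ 2
  triangle-inequality (x₁ , y₁) (x₂ , y₂) (x₃ , y₃) {a} {b} 0≤a 0≤b a²≈ b²≈ =
    ≤-resp-≈ expand-u+v expand-a+b
      (+-mono-≤ (≤-refl {x = |u|² + |v|²}) (*-monoʳ-≤ (fromℕ-nonNeg 2) u·v≤ab))
    where
    u₁ u₂ v₁ v₂ u·v |u|² |v|² : ℝ
    u₁ = x₁ - x₂
    u₂ = y₁ - y₂
    v₁ = x₂ - x₃
    v₂ = y₂ - y₃
    u·v = u₁ * v₁ + u₂ * v₂
    |u|² = u₁ ^ 2 + u₂ ^ 2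
    |v|² = v₁ ^ 2 + v₂ ^ 2

    -- Cauchy-Schwarz, with Lagrange's identity supplying the gap as the square of the determinant
    -- of the two vectors.
    u·v≤ab : u·v ≤ a * b
    u·v≤ab = ^-cancel-≤ 1 (*-nonNeg 0≤a 0≤b) (≤-respʳ-≈
      (trans (*-cong (sym a²≈) (sym b²≈))
        (solve 2 (λ a b → a :^ 2 :* b :^ 2 := (a :* b) :^ 2) refl a b))
      (≤-by-gap (0≤x^2 (u₁ * v₂ - u₂ * v₁))
        (solve 4 (λ u₁ u₂ v₁ v₂ → (u₁ :* v₂ :- u₂ :* v₁) :^ 2
           := (u₁ :^ 2 :+ u₂ :^ 2) :* (v₁ :^ 2 :+ v₂ :^ 2) :- (u₁ :* v₁ :+ u₂ :* v₂) :^ 2)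
          refl u₁ u₂ v₁ v₂)))

    expand-u+v : |u|² + |v|² + fromℕ 2 * u·v ≈ (x₁ - x₃) ^ 2 + (y₁ - y₃) ^ 2
    expand-u+v = solve 6 (λ x₁ y₁ x₂ y₂ x₃ y₃ →
         ((x₁ :- x₂) :^ 2 :+ (y₁ :- y₂) :^ 2) :+ ((x₂ :- x₃) :^ 2 :+ (y₂ :- y₃) :^ 2)
           :+ con (+ 2) :* ((x₁ :- x₂) :* (x₂ :- x₃) :+ (y₁ :- y₂) :* (y₂ :- y₃))
      := (x₁ :- x₃) :^ 2 :+ (y₁ :- y₃) :^ 2) refl x₁ y₁ x₂ y₂ x₃ y₃

    expand-a+b : |u|² + |v|² + fromℕ 2 * (a * b) ≈ (a + b) ^ 2
    expand-a+b = trans (+-congʳ (+-cong (sym a²≈) (sym b²≈)))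
      (solve 2 (λ a b → a :^ 2 :+ b :^ 2 :+ con (+ 2) :* (a :* b) := (a :+ b) :^ 2) refl a b)

  -- Both sides equal the squared norm of |p|²q - |q|²p.
  circumcentre-identity : ∀ p₁ p₂ q₁ q₂ o₁ o₂ →
    fromℕ 2 * (o₁ * p₁ + o₂ * p₂) ≈ p₁ ^ 2 + p₂ ^ 2 →
    fromℕ 2 * (o₁ * q₁ + o₂ * q₂) ≈ q₁ ^ 2 + q₂ ^ 2 →
    fromℕ 4 * (o₁ ^ 2 + o₂ ^ 2) * (p₁ * q₂ - q₁ * p₂) ^ 2 ≈
    (p₁ ^ 2 + p₂ ^ 2) * ((p₁ - q₁) ^ 2 + (p₂ - q₂) ^ 2) * (q₁ ^ 2 + q₂ ^ 2)
  circumcentre-identity p₁ p₂ q₁ q₂ o₁ o₂ 2o·p≈|p|² 2o·q≈|q|² = begin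
    fromℕ 4 * (o₁ ^ 2 + o₂ ^ 2) * (p₁ * q₂ - q₁ * p₂) ^ 2
      -- The vector `(o·p)q - (o·q)p` is `o` turned by a right angle and scaled by
      -- `p₁ * q₂ - q₁ * p₂`, which explains its norm.
      ≈⟨ solve 6 (λ p₁ p₂ q₁ q₂ o₁ o₂ →
           con (+ 4) :* (o₁ :^ 2 :+ o₂ :^ 2) :* (p₁ :* q₂ :- q₁ :* p₂) :^ 2 :=
           (con (+ 2) :* (o₁ :* p₁ :+ o₂ :* p₂) :* q₁
             :- con (+ 2) :* (o₁ :* q₁ :+ o₂ :* q₂) :* p₁) :^ 2 :+
           (con (+ 2) :* (o₁ :* p₁ :+ o₂ :* p₂) :* q₂
             :- con (+ 2) :* (o₁ :* q₁ :+ o₂ :* q₂) :* p₂) :^ 2)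
           refl p₁ p₂ q₁ q₂ o₁ o₂ ⟩
    sq (fromℕ 2 * (o₁ * p₁ + o₂ * p₂)) (fromℕ 2 * (o₁ * q₁ + o₂ * q₂))
      ≈⟨ +-cong (^-congˡ 2 (+-cong (*-congʳ 2o·p≈|p|²) (-‿cong (*-congʳ 2o·q≈|q|²))))
                (^-congˡ 2 (+-cong (*-congʳ 2o·p≈|p|²) (-‿cong (*-congʳ 2o·q≈|q|²)))) ⟩
    sq (p₁ ^ 2 + p₂ ^ 2) (q₁ ^ 2 + q₂ ^ 2)
      ≈⟨ solve 4 (λ p₁ p₂ q₁ q₂ →
           ((p₁ :^ 2 :+ p₂ :^ 2) :* q₁ :- (q₁ :^ 2 :+ q₂ :^ 2) :* p₁) :^ 2 :+
           ((p₁ :^ 2 :+ p₂ :^ 2) :* q₂ :- (q₁ :^ 2 :+ q₂ :^ 2) :* p₂) :^ 2 :=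
           (p₁ :^ 2 :+ p₂ :^ 2) :* ((p₁ :- q₁) :^ 2 :+ (p₂ :- q₂) :^ 2) :* (q₁ :^ 2 :+ q₂ :^ 2))
           refl p₁ p₂ q₁ q₂ ⟩
    (p₁ ^ 2 + p₂ ^ 2) * ((p₁ - q₁) ^ 2 + (p₂ - q₂) ^ 2) * (q₁ ^ 2 + q₂ ^ 2) ∎
    where
    open SetoidReasoning setoid
    sq : ℝ → ℝ → ℝ
    sq X Y = (X * q₁ - Y * p₁) ^ 2 + (X * q₂ - Y * p₂) ^ 2

  -- The square of the classical `4 · radius · area = product of the sides`, where `r` is the
  -- squared radius. Taking `A` as origin turns `B`, `C`, `O` into the vectors `p`, `q`, `o` of
  -- `circumcentre-identity`.
  circumradius-formula : ∀ O A B C {r} →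
    sqDist O A ≈ r → sqDist O B ≈ r → sqDist O C ≈ r →
    fromℕ 4 * r * det A B C ^ 2 ≈ sqDist A B * sqDist B C * sqDist A C
  circumradius-formula (x₀ , y₀) (x₁ , y₁) (x₂ , y₂) (x₃ , y₃) {r} OA≈r OB≈r OC≈r =
    trans (*-congʳ (*-congˡ (sym OA≈r)))
      (trans (circumcentre-identity _ _ _ _ _ _
                (equidistant x₂ y₂ OB≈r) (equidistant x₃ y₃ OC≈r))
        (*-cong (*-cong (flip x₂ y₂) p-q) (flip x₃ y₃)))
    where
    flip : ∀ x y → (x - x₁) ^ 2 + (y - y₁) ^ 2 ≈ (x₁ - x) ^ 2 + (y₁ - y) ^ 2
    flip x y = solve 4 (λ x₁ y₁ x y →
      (x :- x₁) :^ 2 :+ (y :- y₁) :^ 2 := (x₁ :- x) :^ 2 :+ (y₁ :- y) :^ 2) refl x₁ y₁ x y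

    p-q : ((x₂ - x₁) - (x₃ - x₁)) ^ 2 + ((y₂ - y₁) - (y₃ - y₁)) ^ 2 ≈
          (x₂ - x₃) ^ 2 + (y₂ - y₃) ^ 2
    p-q = solve 6 (λ x₁ y₁ x₂ y₂ x₃ y₃ →
      ((x₂ :- x₁) :- (x₃ :- x₁)) :^ 2 :+ ((y₂ :- y₁) :- (y₃ :- y₁)) :^ 2 :=
      (x₂ :- x₃) :^ 2 :+ (y₂ :- y₃) :^ 2) refl x₁ y₁ x₂ y₂ x₃ y₃

    -- With `A` as origin, `|o|² = |o - p|²` expands to `2 o·p = |p|²`.
    equidistant : ∀ x y → sqDist (x₀ , y₀) (x , y) ≈ r →
      fromℕ 2 * ((x₀ - x₁) * (x - x₁) + (y₀ - y₁) * (y - y₁)) ≈ (x - x₁) ^ 2 + (y - y₁) ^ 2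
    equidistant x y OP≈r = begin
      fromℕ 2 * ((x₀ - x₁) * (x - x₁) + (y₀ - y₁) * (y - y₁))
        ≈⟨ solve 6 (λ x₀ y₀ x₁ y₁ x y →
             con (+ 2) :* ((x₀ :- x₁) :* (x :- x₁) :+ (y₀ :- y₁) :* (y :- y₁)) :=
             ((x :- x₁) :^ 2 :+ (y :- y₁) :^ 2)
               :+ (((x₀ :- x₁) :^ 2 :+ (y₀ :- y₁) :^ 2) :- ((x₀ :- x) :^ 2 :+ (y₀ :- y) :^ 2)))
             refl x₀ y₀ x₁ y₁ x y ⟩
      ((x - x₁) ^ 2 + (y - y₁) ^ 2) + (sqDist (x₀ , y₀) (x₁ , y₁) - sqDist (x₀ , y₀) (x , y))
        ≈⟨ +-congˡ (+-cong OA≈r (-‿cong OP≈r)) ⟩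
      ((x - x₁) ^ 2 + (y - y₁) ^ 2) + (r - r)
        ≈⟨ +-congˡ (-‿inverseʳ r) ⟩
      ((x - x₁) ^ 2 + (y - y₁) ^ 2) + 0#
        ≈⟨ +-identityʳ _ ⟩
      (x - x₁) ^ 2 + (y - y₁) ^ 2 ∎
      where open SetoidReasoning setoid

  adjacent-chords : ∀ A B C {a b A₀ R₀} → 0# ≤ a → 0# ≤ b →
    a ^ 2 ≈ sqDist A B → b ^ 2 ≈ sqDist B C → 0# < A₀ → 0# < R₀ →
    A₀ / fromℕ 2 ≤ triangleArea A B C →
    (∃[ O ] ∃[ R ] R₀ ≤ R × OnCircle O R A × OnCircle O R B × OnCircle O R C) →
    fromℕ 2 * root 3 (A₀ * R₀) ≤ a + b
  adjacent-chords A B C {a} {b} {A₀} {R₀} 0≤a 0≤b a²≈ b²≈ 0<A₀ 0<R₀ area≥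
    (O , R , R₀≤R , OA≈R , OB≈R , OC≈R) =
    -- It suffices to show `A₀ * R₀ ≤ h ^ 3` for the half-sum `h`: then `root-least` puts the cube
    -- root below `h`, and doubling gives the claim.
    ≤-respʳ-≈ 2h≈a+b (*-monoʳ-≤ (fromℕ-nonNeg 2) (root-least 2 0≤h A₀R₀≤h³))
    where
    h D : ℝ
    h = (a + b) / fromℕ 2
    D = det A B C

    0≤A₀ : 0# ≤ A₀
    0≤A₀ = proj₁ 0<A₀

    0≤R₀ : 0# ≤ R₀
    0≤R₀ = proj₁ 0<R₀

    0≤a+b : 0# ≤ a + b
    0≤a+b = +-nonNeg 0≤a 0≤b

    0≤h : 0# ≤ h
    0≤h = /-nonNeg 0≤a+b (fromℕ-pos 1)

    2h≈a+b : fromℕ 2 * h ≈ a + b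
    2h≈a+b = x*[y/x]≈y (fromℕ-pos 1) (a + b)

    -- The 2 under `A₀` in the hypothesis cancels the 2 in the definition of `triangleArea`.
    A₀≤∣D∣ : A₀ ≤ ∣ D ∣
    A₀≤∣D∣ = ≤-resp-≈ (x*[y/x]≈y (fromℕ-pos 1) A₀) (x*[y/x]≈y (fromℕ-pos 1) ∣ D ∣)
      (*-monoʳ-≤ (fromℕ-nonNeg 2) area≥)

    A₀²≤D² : A₀ ^ 2 ≤ D ^ 2
    A₀²≤D² = ≤-respʳ-≈ (∣x∣^2≈x^2 D) (^-mono-≤ 2 0≤A₀ A₀≤∣D∣)

    on-circle : ∀ {P} → OnCircle O R P → sqDist O P ≈ R ^ 2
    on-circle {P} OP≈R = trans (sym (dist-square O P)) (^-congˡ 2 OP≈R)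

    4R²D²≈ : fromℕ 4 * R ^ 2 * D ^ 2 ≈ a ^ 2 * b ^ 2 * sqDist A C
    4R²D²≈ = trans
      (circumradius-formula O A B C (on-circle OA≈R) (on-circle OB≈R) (on-circle OC≈R))
      (*-congʳ (*-cong (sym a²≈) (sym b²≈)))

    -- Compared after squaring: `4R₀²A₀² ≤ 4R²D² = a²b²|AC|² ≤ a²b²(a + b)²`.
    2A₀R₀≤ab[a+b] : fromℕ 2 * (A₀ * R₀) ≤ a * b * (a + b)
    2A₀R₀≤ab[a+b] = ^-cancel-≤ 1 (*-nonNeg (*-nonNeg 0≤a 0≤b) 0≤a+b) (≤-resp-≈
      (solve 2 (λ A₀ R₀ → con (+ 4) :* R₀ :^ 2 :* A₀ :^ 2
                       := (con (+ 2) :* (A₀ :* R₀)) :^ 2) refl A₀ R₀)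
      (solve 2 (λ a b → a :^ 2 :* b :^ 2 :* (a :+ b) :^ 2
                     := (a :* b :* (a :+ b)) :^ 2) refl a b)
      (≤-trans
        (*-mono-≤ (*-nonNeg (fromℕ-nonNeg 4) (0≤x^2 R₀)) (0≤x^2 D)
          (*-monoʳ-≤ (fromℕ-nonNeg 4) (^-mono-≤ 2 0≤R₀ R₀≤R)) A₀²≤D²)
        (≤-respˡ-≈ (sym 4R²D²≈) (*-monoʳ-≤ (*-nonNeg (0≤x^2 a) (0≤x^2 b))
          (triangle-inequality A B C 0≤a 0≤b a²≈ b²≈)))))

    -- AM-GM in the form `(a + b)² - 4ab = (a - b)²`, multiplied by `a + b`.
    4ab[a+b]≤[a+b]³ : fromℕ 4 * (a * b * (a + b)) ≤ (a + b) ^ 3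
    4ab[a+b]≤[a+b]³ = ≤-by-gap (*-nonNeg 0≤a+b (0≤x^2 (a - b)))
      (solve 2 (λ a b → (a :+ b) :* (a :- b) :^ 2
                     := (a :+ b) :^ 3 :- con (+ 4) :* (a :* b :* (a :+ b))) refl a b)

    A₀R₀≤h³ : A₀ * R₀ ≤ h ^ 3
    -- The factor cancelled is 8, since `fromℕ-pos 7` concerns `fromℕ 8`: it is 4 times 2 on the
    -- left and the cube of 2 on the right.
    A₀R₀≤h³ = *-cancelˡ-≤ (fromℕ-pos 7) (≤-resp-≈
      (solve 1 (λ x → con (+ 4) :* (con (+ 2) :* x) := con (+ 8) :* x) refl (A₀ * R₀))
      (trans (^-congˡ 3 (sym 2h≈a+b))
        (solve 1 (λ h → (con (+ 2) :* h) :^ 3 := con (+ 8) :* h :^ 3) refl h))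
      (≤-trans (*-monoʳ-≤ (fromℕ-nonNeg 4) 2A₀R₀≤ab[a+b]) 4ab[a+b]≤[a+b]³))

  -- The first term, which lies in one pair only, is kept on the left for the induction.
  sum-of-adjacent-pairs : ∀ m (d : Fin (suc m) → ℝ) {e} → (∀ i → 0# < d i) →
    (∀ i → e ≤ d (inject₁ i) + d (fsuc i)) → fromℕ m * e + d fzero < sum d + sum d
  -- With one term and no pair the claim is `x < x + x`. The strictness of the whole bound comes
  -- from here, from the positivity of the last term.
  sum-of-adjacent-pairs zero d {e} d-pos _ = <-resp-≈
    (solve 2 (λ x e → x :+ con (+ 0) := con (+ 0) :* e :+ x) refl (d fzero) e)
    (solve 1 (λ x → x :+ x := (x :+ con (+ 0)) :+ (x :+ con (+ 0))) refl (d fzero))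
    (+-monoʳ-< (d fzero) (d-pos fzero))
  -- Writing `x`, `y` for the first two terms, `x - y` is added to the pair bound `e ≤ x + y`, so
  -- that `- y` cancels the term kept by the induction hypothesis.
  sum-of-adjacent-pairs (suc m) d {e} d-pos pairs = <-resp-≈
    (trans (solve 4 (λ e x y n → (e :- y :+ x) :+ (n :* e :+ y) := (e :+ n :* e) :+ x)
             refl e (d fzero) (d (fsuc fzero)) (fromℕ m))
           (+-congʳ (trans (+-congʳ (sym (*-identityˡ e))) (sym (distribʳ e 1# (fromℕ m))))))
    (solve 3 (λ x y S → (x :+ y) :- y :+ x :+ (S :+ S) := (x :+ S) :+ (x :+ S))
      refl (d fzero) (d (fsuc fzero)) (sum λ i → d (fsuc i)))
    (≤-<-trans
      (+-mono-≤ (+-mono-≤ (+-mono-≤ (pairs fzero) ≤-refl) ≤-refl) ≤-refl)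
      (+-monoʳ-< _ (sum-of-adjacent-pairs m (λ i → d (fsuc i))
        (λ i → d-pos (fsuc i)) (λ i → pairs (fsuc i)))))

  -- Inscribed polygons and the bound on the number of points.

  module _ (C : ImmersedCurve) where
    open ImmersedCurve C

    -- A polygon with a single vertex has the empty sum as its length. This makes the length of the
    -- curve nonnegative, which settles the cases of at most one point.
    0-inscribed : InscribedLength C 0#
    0-inscribed = 0 , (λ _ → t₀) , (λ _ → t₀∈I) , (λ _ _ _ → ≤-refl) , refl
      where
      t₀ : ℝ
      t₀ = proj₁ (IsInterval.nondegenerate isInterval)
      t₀∈I : Domain t₀
      t₀∈I = proj₁ (proj₂ (proj₂ (IsInterval.nondegenerate isInterval)))

  module _ (C : ImmersedCurve) {L : ℝ} (isLength : IsLength C [ L ])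
           {A₀ R₀ : ℝ} (0<A₀ : 0# < A₀) (0<R₀ : 0# < R₀) where
    open ImmersedCurve C

    c : ℝ
    c = root 3 (A₀ * R₀)

    0<c : 0# < c
    0<c = root-pos 2 (*-pos 0<A₀ 0<R₀)

    inscribed≤L : ∀ {ℓ} → InscribedLength C ℓ → ℓ ≤ L
    inscribed≤L ins = AddSupremumNonStrict.[≤]-injective _≤_ (proj₁ isLength ins)

    0≤L/c : 0# ≤ L / c
    0≤L/c = /-nonNeg (inscribed≤L (0-inscribed C)) 0<c

    vertex-bound : ∀ N (P : Fin N → Point) → Distinct P → InOrderAlong C P →
      (∀ i j k → Consecutive i j k → A₀ / fromℕ 2 ≤ triangleArea (P i) (P j) (P k)) →
      (∀ i j k → Consecutive i j k →
        ∃[ O ] ∃[ R ] R₀ ≤ R × OnCircle O R (P i) × OnCircle O R (P j) × OnCircle O R (P k)) →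
      fromℕ N < fromℕ 2 + L / c
    vertex-bound 0 _ _ _ _ _ = 0<x⇒0<x+y (fromℕ-pos 1) 0≤L/c
    vertex-bound 1 _ _ _ _ _ = <-≤-trans (+-monoʳ-< 1# (fromℕ-pos 0))
      (≤-respˡ-≈ (+-identityʳ _) (+-monoʳ-≤ _ 0≤L/c))
    -- There are `m + 2` points, hence `m + 1` chords and `m` adjacent pairs. Removing 2 from both
    -- sides leaves `m < L / c`, proved after multiplication by `2c`.
    vertex-bound (suc (suc m)) P distinct (t , t∈I , t-mono , P≈γt) areas circles = <-resp-≈
      (solve 2 (λ 𝟙 n → (𝟙 :+ (𝟙 :+ con (+ 0))) :+ n := 𝟙 :+ (𝟙 :+ n)) refl 1# (fromℕ m)) refl
      (+-monoʳ-< (fromℕ 2) (*-cancelˡ-< (proj₁ 0<2c) 2cm<2c[L/c]))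
      where
      -- Chords are measured between points of `γ`, so that their sum is literally an inscribed
      -- length; `d²` carries their squares over to `P`, where the area and circle hypotheses live.
      d : Fin (suc m) → ℝ
      d i = dist (γ (t (inject₁ i))) (γ (t (fsuc i)))

      inject₁<fsuc : ∀ (i : Fin (suc m)) → inject₁ i <ᶠ fsuc i
      inject₁<fsuc i = ℕ.s≤s (ℕ.≤-reflexive (Fin.toℕ-inject₁ i))

      d² : ∀ i → d i ^ 2 ≈ sqDist (P (inject₁ i)) (P (fsuc i))
      d² i = trans (dist-square _ _) (sym (sqDist-cong (P≈γt _) (P≈γt _)))

      d-pos : ∀ i → 0# < d i
      d-pos i = dist-pos _ _ λ (x≈ , y≈) → distinct _ _ (Fin.<⇒≢ (inject₁<fsuc i))
        ( trans (proj₁ (P≈γt _)) (trans x≈ (sym (proj₁ (P≈γt _))))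
        , trans (proj₂ (P≈γt _)) (trans y≈ (sym (proj₂ (P≈γt _)))) )

      -- The middle index `inject₁ (fsuc i)` reduces to `fsuc (inject₁ i)`, so the end of one chord
      -- is definitionally the start of the next.
      consecutive : ∀ (i : Fin m) → Consecutive (inject₁ (inject₁ i)) (inject₁ (fsuc i)) (fsuc (fsuc i))
      consecutive i = ≡.cong suc (≡.sym (Fin.toℕ-inject₁ (inject₁ i)))
                    , ≡.cong (λ k → suc (suc k)) (≡.sym (Fin.toℕ-inject₁ i))

      pairs : ∀ i → fromℕ 2 * c ≤ d (inject₁ i) + d (fsuc i)
      pairs i = adjacent-chords _ _ _ (dist-nonNeg _ _) (dist-nonNeg _ _)
        (d² (inject₁ i)) (d² (fsuc i)) 0<A₀ 0<R₀
        (areas _ _ _ (consecutive i)) (circles _ _ _ (consecutive i))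

      t-mono-≤ : ∀ i j → i ≤ᶠ j → t i ≤ t j
      t-mono-≤ i j i≤j with ℕ.m≤n⇒m<n∨m≡n i≤j
      ... | inj₁ i<j = proj₁ (t-mono i j i<j)
      ... | inj₂ i≡j with Fin.toℕ-injective i≡j
      ...   | ≡.refl = ≤-refl

      sum-d≤L : sum d ≤ L
      sum-d≤L = inscribed≤L (suc m , t , t∈I , t-mono-≤ , refl)

      0<2c : 0# < fromℕ 2 * c
      0<2c = *-pos (fromℕ-pos 1) 0<c

      2L≈2c[L/c] : L + L ≈ fromℕ 2 * c * (L / c)
      2L≈2c[L/c] = trans (+-cong (sym (x*[y/x]≈y 0<c L)) (sym (x*[y/x]≈y 0<c L)))
        (solve 2 (λ c q → c :* q :+ c :* q := con (+ 2) :* c :* q) refl c (L / c))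

      2cm<2c[L/c] : fromℕ 2 * c * fromℕ m < fromℕ 2 * c * (L / c)
      -- The first chord on the left of `sum-of-adjacent-pairs` is replaced by 0; the inequality
      -- there is already strict.
      2cm<2c[L/c] = <-resp-≈ (trans (+-identityʳ _) (*-comm _ _)) 2L≈2c[L/c]
        (≤-<-trans (+-monoʳ-≤ _ (proj₁ (d-pos fzero)))
          (<-≤-trans (sum-of-adjacent-pairs m d d-pos pairs) (+-mono-≤ sum-d≤L sum-d≤L)))

theorem3p3 : (reals : RealNumbers) →
    let open RealPlane reals in
    (C : ImmersedCurve) (L : ℝ ⁺) → IsLength C L →
    (N : ℕ) (P : Fin N → Point) → Distinct P → InOrderAlong C P →
    (A₀ R₀ : ℝ) → 0# < A₀ → 0# < R₀ →
    (∀ i j k → Consecutive i j k → A₀ / fromℕ 2 ≤ triangleArea (P i) (P j) (P k)) →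
    (∀ i j k → Consecutive i j k →
    ∃[ O ] ∃[ R ] R₀ ≤ R × OnCircle O R (P i) × OnCircle O R (P j) × OnCircle O R (P k)) →
    [ fromℕ N ] <⁺ fromℕ 2 +⁺ L /⁺ root 3 (A₀ * R₀)
theorem3p3 reals C [ L ] isLength N P distinct inOrder A₀ R₀ 0<A₀ 0<R₀ areas circles =
  AddSupremumStrict.[ OrderedField.vertex-bound reals C isLength 0<A₀ 0<R₀
      N P distinct inOrder areas circles ]
-- For infinite length the right-hand side computes to `⊤⁺`, which exceeds every real number.
theorem3p3 reals C ⊤⁺ _ N _ _ _ _ _ _ _ _ _ =
  AddSupremumStrict.[ RealPlane.fromℕ reals N ]<⊤⁺
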